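{- There is a constant $b>0$ such that for each integer $k\ge 50$ there is an infinite class $\mathbf{G}$ of graphs of maximum degree at most $5$, each of treewidth at most $k$, such that for each $G\in\mathbf{G}$, $\mathrm{dmw}(G)\ge (\log_2 n\cdot k)/b$, where $n=|V(G)|$.
   Context: A matching $M$ of $G$ is distant if no two vertices incident to distinct edges of $M$ are adjacent or have a common neighbour. $\mathrm{dmw}(G)$ (distant matching width) is the minimum, over all orderings $SV$ of $V(G)$, of the maximum, over all prefixes $V_1$ of $SV$, of the size of a largest distant matching all of whose edges have one end in $V_1$ and the other in $V(G)\setminus V_1$. -}

module Defs where

open import Data.Nat using (ℕ; zero; suc; _≤_; _<_)
open import Data.Fin using (Fin; toℕ) renaming (suc to fsuc)
open import Data.Fin.Subset using (Subset; _∈_; _∉_; ∣_∣)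
open import Data.Fin.Permutation using (Permutation′; _⟨$⟩ʳ_)
open import Data.List using (List; length)
open import Data.List.Relation.Unary.AllPairs using (AllPairs)
open import Data.List.Relation.Unary.All using (All)
open import Data.Product using (Σ; _×_; _,_; ∃; proj₁; proj₂)
open import Data.Sum using (_⊎_)
open import Relation.Binary.PropositionalEquality using (_≡_)
open import Relation.Nullary using (¬_)

record Graph (n : ℕ) : Set where
  field
    nbr    : Fin n → Subset n
    sym    : ∀ {u v} → u ∈ nbr v → v ∈ nbr u
    irrefl : ∀ {v} → v ∉ nbr v
open Graph public

Adj : ∀ {n} → Graph n → Fin n → Fin n → Set
Adj G u v = v ∈ nbr G u

MaxDegree≤ : ∀ {n} → Graph n → ℕ → Set
MaxDegree≤ G d = ∀ v → ∣ nbr G v ∣ ≤ d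

-- Finite trees: a tree on nodes Fin (suc m) is given by a parent map,
-- node (fsuc i) having parent par i with a strictly smaller index.
-- (Every finite tree admits such a labelling, e.g. in BFS order.)

record Tree : Set where
  field
    m      : ℕ
    par    : Fin m → Fin (suc m)
    par-lt : ∀ i → toℕ (par i) ≤ toℕ i
open Tree public

Node : Tree → Set
Node T = Fin (suc (m T))

TEdge : (T : Tree) → Node T → Node T → Set
TEdge T a b = ∃ λ i → (a ≡ fsuc i × b ≡ par T i) ⊎ (b ≡ fsuc i × a ≡ par T i)

data WalkIn (T : Tree) (P : Node T → Set) : Node T → Node T → Set where
  here : ∀ {a} → P a → WalkIn T P a a
  step : ∀ {a b c} → P a → TEdge T a b → WalkIn T P b c → WalkIn T P a c

record TreeDecomposition {n : ℕ} (G : Graph n) (k : ℕ) : Set where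
  field
    tree       : Tree
    bag        : Node tree → Subset n
    bag-size   : ∀ t → ∣ bag t ∣ ≤ suc k
    cover-vert : ∀ v → ∃ λ t → v ∈ bag t
    cover-edge : ∀ u v → Adj G u v → ∃ λ t → u ∈ bag t × v ∈ bag t
    connected  : ∀ v t t' → v ∈ bag t → v ∈ bag t' →
                 WalkIn tree (λ s → v ∈ bag s) t t'

TreewidthAtMost : ∀ {n} → Graph n → ℕ → Set
TreewidthAtMost G k = TreeDecomposition G k

Close : ∀ {n} → Graph n → Fin n → Fin n → Set
Close G x y = x ≡ y ⊎ Adj G x y ⊎ (∃ λ w → Adj G x w × Adj G w y)

Edge : ℕ → Set
Edge n = Fin n × Fin n

Far : ∀ {n} → Graph n → Edge n → Edge n → Set
Far G (a , b) (c , d) =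
  ¬ Close G a c × ¬ Close G a d × ¬ Close G b c × ¬ Close G b d

-- M (a list of edges, listed once each) is a distant matching of G.
-- Pairwise farness also forces the edges to be distinct and vertex-disjoint.
DistantMatching : ∀ {n} → Graph n → List (Edge n) → Set
DistantMatching G M = All (λ e → Adj G (proj₁ e) (proj₂ e)) M × AllPairs (Far G) M

-- the prefix of length i of the ordering σ (σ maps a vertex to its position)
InPrefix : ∀ {n} → Permutation′ n → ℕ → Fin n → Set
InPrefix σ i v = toℕ (σ ⟨$⟩ʳ v) < i

CrossingP : ∀ {n} → Permutation′ n → ℕ → List (Edge n) → Set
CrossingP σ i M = All (λ e → InPrefix σ i (proj₁ e) × ¬ InPrefix σ i (proj₂ e)) M

DmwAtMost : ∀ {n} → Graph n → ℕ → Set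
DmwAtMost {n} G d =
  Σ (Permutation′ n) λ σ → ∀ (i : ℕ) → i ≤ n → ∀ (M : List (Edge n)) →
    DistantMatching G M → CrossingP σ i M → length M ≤ d

{-# OPTIONS --safe #-}
-- G is the Cartesian product of a tree T_h with a path on p ≈ k/2 vertices. The bags consisting of
-- the columns over a node and its parent give treewidth below 2p. Here T_0 has more than 2p nodes
-- and T_{h+1} joins three copies of T_h through two new nodes, so log n = O(h) once h is large.
--
-- Every vertex ordering has a prefix cut by at least h p edges: each copy of T_{h-1} has, by
-- induction, a time at which it is cut by (h-1) p edges while p of its columns meet the prefix and p
-- of its columns meet the complement. At the median of the three times, the first copy still has p columns
-- meeting the prefix and the last one p columns meeting the complement. Outside the middle copy,
-- either every row is bichromatic, or some row is monochromatic and p columns are bichromatic; both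
-- give p new cut edges. At degree at most 5 an edge is not far from at most 620 edges, so greedy
-- selection turns hp cut edges into a distant matching of size hp / 621.
module Submission where

open import Defs
open import Data.Nat using (ℕ; _≤_; _*_; _^_)
open import Data.Product using (Σ; _×_)

open import Data.Bool using (Bool; true; false; T)
open import Data.Fin using (Fin; zero; suc; toℕ; _↑ˡ_; _↑ʳ_; splitAt; inject₁; combine; remQuot)
open import Data.Fin.Permutation using (_⟨$⟩ʳ_; _⟨$⟩ˡ_; inverseˡ)
open import Data.Fin.Properties as Finₚ using (splitAt-↑ˡ; splitAt-↑ʳ; splitAt⁻¹-↑ˡ; splitAt⁻¹-↑ʳ; toℕ-↑ˡ; toℕ-↑ʳ; toℕ-inject₁; toℕ-injective; toℕ<n; remQuot-combine; combine-remQuot)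
open import Data.Fin.Subset as Subset using (Subset; ⁅_⁆; _∪_; ∣_∣)
import Data.Fin.Subset.Properties as Subsetₚ
open import Data.List using (List; []; _∷_; [_]; _++_; length; map; filter; allFin; concatMap; fromMaybe)
import Data.List.Membership.DecPropositional as DecMembership
open import Data.List.Membership.Propositional using (_∈_; _∉_; lose)
open import Data.List.Membership.Propositional.Properties using (∈-map⁺; ∈-map⁻; ∈-∃++; ∈-++⁺ˡ; ∈-++⁺ʳ; ∈-++⁻; ∈-allFin; ∈-concatMap⁺; ∈-filter⁻)
open import Data.List.Properties using (length-map; length-++; length-tabulate; length-filter; filter-all; filter-none)
open import Data.List.Relation.Unary.All as All using (All; []; _∷_)
import Data.List.Relation.Unary.All.Properties as Allₚ
open import Data.List.Relation.Unary.AllPairs using ([]; _∷_)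
open import Data.List.Relation.Unary.Any using (here; there)
open import Data.List.Relation.Unary.Unique.Propositional using (Unique)
import Data.List.Relation.Unary.Unique.Propositional.Properties as Uniqueₚ
open import Data.Maybe using (Maybe; just; nothing; maybe′)
open import Data.Nat using (zero; suc; _+_; _<_; z≤n; s≤s; _<?_; _≤?_)
open import Data.Nat.Properties
open import Data.Nat.Solver using (module +-*-Solver)
open import Data.Product as Product using (_,_; ∃; proj₁; proj₂)
open import Data.Product.Properties using (≡-dec)
open import Data.Sum using (_⊎_; inj₁; inj₂; swap; [_,_]′)
open import Data.Unit using (⊤; tt)
open import Data.Vec using ([]; _∷_)
open import Function using (_∘_; id)
open import Relation.Binary.PropositionalEquality using (_≡_; _≢_; refl; trans; cong; cong₂; subst) renaming (sym to ≡-sym)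
open import Relation.Nullary using (¬_; yes; no; does; contradiction)
open import Relation.Nullary.Decidable using (dec-true; dec-false)
open import Relation.Unary using (Decidable)
open import Relation.Unary.Properties using (∁?)

-- Lists and two-colourings

record CutEdge {A : Set} (_~_ : A → A → Set) (R : A → Set) (c : A → Bool) : Set where
  constructor cutEdge
  field
    {source} {target} : A
    adjacent : source ~ target
    source∈R : R source
    inside   : c source ≡ true
    outside  : c target ≡ false

-- Connectedness of x and y inside R, phrased through what it is needed for: a two-colouring that
-- separates x from y has a bichromatic edge that starts in R.
Linked : {A : Set} (_~_ : A → A → Set) (R : A → Set) → A → A → Set
Linked _~_ R x y = ∀ c → c x ≡ c y ⊎ CutEdge _~_ R c

module _ {A : Set} {_~_ : A → A → Set} {R : A → Set} where

  linked-refl : ∀ {x} → Linked _~_ R x x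
  linked-refl c = inj₁ refl

  linked-sym : ∀ {x y} → Linked _~_ R x y → Linked _~_ R y x
  linked-sym x-y c with x-y c
  ... | inj₁ eq = inj₁ (≡-sym eq)
  ... | inj₂ e  = inj₂ e

  linked-trans : ∀ {x y z} → Linked _~_ R x y → Linked _~_ R y z → Linked _~_ R x z
  linked-trans x-y y-z c with x-y c | y-z c
  ... | inj₂ e | _      = inj₂ e
  ... | inj₁ _ | inj₂ e = inj₂ e
  ... | inj₁ p | inj₁ q = inj₁ (trans p q)

  -- Both ends must lie in `R`: the colouring decides which of them is the source of the cut edge.
  linked-edge : (∀ {x y} → x ~ y → y ~ x) → ∀ {x y} → x ~ y → R x → R y → Linked _~_ R x y
  linked-edge ~-sym {x} {y} x~y Rx Ry c with c x in cx | c y in cy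
  ... | true  | true  = inj₁ refl
  ... | false | false = inj₁ refl
  ... | true  | false = inj₂ (cutEdge x~y Rx cx cy)
  ... | false | true  = inj₂ (cutEdge (~-sym x~y) Ry cy cx)

  linked-all : ∀ {r xs} → All (Linked _~_ R r) xs → ∀ c →
               CutEdge _~_ R c ⊎ All (λ x → c r ≡ c x) xs
  linked-all []       c = inj₂ []
  linked-all (l ∷ ls) c with l c | linked-all ls c
  ... | inj₂ e | _       = inj₁ e
  ... | inj₁ _ | inj₁ e  = inj₁ e
  ... | inj₁ p | inj₂ ps = inj₂ (p ∷ ps)

-- A colouring of `B` is pulled back along `f`, and the cut edge it yields is pushed forward.
linked-map : {A B : Set} {_~_ : A → A → Set} {_≈_ : B → B → Set} {R : A → Set} {S : B → Set}
             (f : A → B) → (∀ {x y} → x ~ y → f x ≈ f y) → (∀ {x} → R x → S (f x)) →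
             ∀ {x y} → Linked _~_ R x y → Linked _≈_ S (f x) (f y)
linked-map f hom R⇒S l c with l (c ∘ f)
... | inj₁ eq = inj₁ eq
... | inj₂ (cutEdge a s i o) = inj₂ (cutEdge (hom a) (R⇒S s) i o)

all⊎any : ∀ {n} {P Q : Fin n → Set} → (∀ i → P i ⊎ Q i) → (∀ i → P i) ⊎ ∃ Q
all⊎any {zero}  f = inj₁ λ ()
all⊎any {suc n} f with f zero | all⊎any (f ∘ suc)
... | inj₂ q | _            = inj₂ (zero , q)
... | inj₁ _ | inj₂ (i , q) = inj₂ (suc i , q)
... | inj₁ p | inj₁ ps      = inj₁ λ { zero → p ; (suc i) → ps i }

-- The equation `map g ys ≡ xs` lets the chosen preimages inherit both length and uniqueness from
-- `xs`.
choose-fibres : {A B : Set} {Q : B → Set} (g : B → A) {xs : List A} →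
                All (λ x → ∃ λ y → g y ≡ x × Q y) xs → ∃ λ ys → map g ys ≡ xs × All Q ys
choose-fibres g [] = [] , refl , []
choose-fibres g ((y , eq , q) ∷ rest) with choose-fibres g rest
... | ys , eqs , qs = y ∷ ys , cong₂ _∷_ eq eqs , q ∷ qs

-- Counting in lists, and medians

length-filter-∁ : {A : Set} {P : A → Set} (P? : Decidable P) (xs : List A) →
                  length xs ≡ length (filter P? xs) + length (filter (∁? P?) xs)
length-filter-∁ P? [] = refl
length-filter-∁ P? (x ∷ xs) with P? x
... | yes _ = cong suc (length-filter-∁ P? xs)
... | no  _ = trans (cong suc (length-filter-∁ P? xs)) (≡-sym (+-suc _ _))

-- Pigeonhole: delete one occurrence of `x` from `ys`; the other entries of `xs` differ from `x` and
-- survive the deletion.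
unique-⊆⇒length≤ : {A : Set} {xs ys : List A} → Unique xs → All (_∈ ys) xs → length xs ≤ length ys
unique-⊆⇒length≤ [] [] = z≤n
unique-⊆⇒length≤ {xs = x ∷ xs} {ys} (x∉xs ∷ xs!) (x∈ys ∷ xs⊆ys) with ∈-∃++ x∈ys
... | as , bs , refl = begin
  suc (length xs)                ≤⟨ s≤s (unique-⊆⇒length≤ xs! (All.zipWith drop-x (x∉xs , xs⊆ys))) ⟩
  suc (length (as ++ bs))        ≡⟨ cong suc (length-++ as) ⟩
  suc (length as + length bs)    ≡⟨ +-suc (length as) (length bs) ⟨
  length as + suc (length bs)    ≡⟨ length-++ as ⟨
  length (as ++ x ∷ bs)          ∎
  where
  open ≤-Reasoning
  drop-x : ∀ {y} → (x ≢ y) × y ∈ as ++ x ∷ bs → y ∈ as ++ bs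
  drop-x (x≢y , y∈) with ∈-++⁻ as y∈
  ... | inj₁ y∈as          = ∈-++⁺ˡ y∈as
  ... | inj₂ (here y≡x)    = contradiction (≡-sym y≡x) x≢y
  ... | inj₂ (there y∈bs)  = ∈-++⁺ʳ as y∈bs

module _ {A : Set} {P Q : A → Set} (P? : Decidable P) (Q? : Decidable Q) where

  length-filter-mono : ∀ {xs} → All (λ x → P x → Q x) xs → length (filter P? xs) ≤ length (filter Q? xs)
  length-filter-mono [] = z≤n
  length-filter-mono (_∷_ {x = x} P⇒Q rest) with P? x | Q? x
  ... | yes _ | yes _ = s≤s (length-filter-mono rest)
  ... | no  _ | yes _ = m≤n⇒m≤1+n (length-filter-mono rest)
  ... | no  _ | no  _ = length-filter-mono rest
  ... | yes p | no ¬q = contradiction (P⇒Q p) ¬q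

  -- Once the single exception `x` has been met, `P` implies `Q` on the rest of the list, and
  -- monotonicity finishes the count.
  length-filter-suc : (∀ {x y} → P x → ¬ Q x → P y → ¬ Q y → x ≡ y) → ∀ {xs} → Unique xs →
                      length (filter P? xs) ≤ suc (length (filter Q? xs))
  length-filter-suc single [] = z≤n
  length-filter-suc single (_∷_ {x = x} x∉xs xs!) with P? x | Q? x
  ... | yes _ | yes _ = s≤s (length-filter-suc single xs!)
  ... | no  _ | yes _ = m≤n⇒m≤1+n (length-filter-suc single xs!)
  ... | no  _ | no  _ = length-filter-suc single xs!
  ... | yes p | no ¬q = s≤s (length-filter-mono (All.map P⇒Q x∉xs))
    where
    P⇒Q : ∀ {y} → x ≢ y → P y → Q y
    P⇒Q {y} x≢y py with Q? y
    ... | yes qy = qy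
    ... | no ¬qy = contradiction (single p ¬q py ¬qy) x≢y

module _ {A : Set} (f : A → ℕ) where

  below? : ∀ s → Decidable (λ x → f x < s)
  below? s x = f x <? s

  below above : ℕ → List A → List A
  below s = filter (below? s)
  above s = filter (∁? (below? s))

  bounded : ∀ xs → ∃ λ s → All (λ x → f x < s) xs
  bounded [] = 0 , []
  bounded (x ∷ xs) with bounded xs
  ... | s , all< = suc (f x) + s , m≤m+n _ s ∷ All.map (λ p → ≤-trans p (m≤n+m s _)) all<

  module _ (f-injective : ∀ {x y} → f x ≡ f y → x ≡ y) {xs : List A} (xs! : Unique xs) where

    below-suc : ∀ s → length (below (suc s) xs) ≤ suc (length (below s xs))
    below-suc s = length-filter-suc (below? (suc s)) (below? s)
      (λ x≤s x≮s y≤s y≮s → f-injective (trans (f≡s x≤s x≮s) (≡-sym (f≡s y≤s y≮s)))) xs!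
      where
      f≡s : ∀ {x} → f x < suc s → ¬ f x < s → f x ≡ s
      f≡s (s≤s p) ¬q = ≤-antisym p (≮⇒≥ ¬q)

    -- Discrete intermediate values: the count below `s` is 0 at `s = 0` and grows by at most one
    -- per step, so it cannot skip `a`.
    threshold : ∀ a s → a ≤ length (below s xs) → ∃ λ t → length (below t xs) ≡ a
    threshold a zero a≤ = 0 , trans none (≡-sym (n≤0⇒n≡0 (subst (a ≤_) none a≤)))
      where
      none : length (below 0 xs) ≡ 0
      none = cong length (filter-none (below? 0) {xs} (All.tabulate λ _ ()))
    threshold a (suc s) a≤ with a ≤? length (below s xs)
    ... | yes a≤′ = threshold a s a≤′
    ... | no  a≰ = suc s , ≤-antisym (≤-trans (below-suc s) (≰⇒> a≰)) a≤

    median : ∀ a → a + a ≤ length xs → ∃ λ s → a ≤ length (below s xs) × a ≤ length (above s xs)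
    median a a+a≤ with bounded xs
    ... | s , all< with threshold a s (subst (λ ys → a ≤ length ys) (≡-sym (filter-all (below? s) all<)) (≤-trans (m≤m+n a a) a+a≤))
    ... | t , refl = t , ≤-refl ,
      +-cancelˡ-≤ a _ _ (subst (a + a ≤_) (length-filter-∁ (below? t) xs) a+a≤)

-- Cuts of a product of a graph with a path

-- Cartesian product of graphs. Below, a column is a fibre {x} × Fin p and a row a fibre V × {i}.
Box : {V : Set} {p : ℕ} → (V → V → Set) → (Fin p → Fin p → Set) → V × Fin p → V × Fin p → Set
Box _~_ _≈_ (x , i) (y , j) = (i ≡ j × x ~ y) ⊎ (x ≡ y × i ≈ j)

module Ordered {V : Set} {q : ℕ} (_~_ : V → V → Set) (_≈_ : Fin (suc q) → Fin (suc q) → Set)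
               (time : V × Fin (suc q) → ℕ) where

  p : ℕ
  p = suc q

  Vertex : Set
  Vertex = V × Fin p

  early : ℕ → V → Fin p → Bool
  early s x i = does (time (x , i) <? s)

  early⇒< : ∀ s x i → early s x i ≡ true → time (x , i) < s
  early⇒< s x i eq = <ᵇ⇒< _ s (subst T (≡-sym eq) tt)

  late⇒≮ : ∀ s x i → early s x i ≡ false → ¬ time (x , i) < s
  late⇒≮ s x i eq lt with trans (≡-sym (dec-true (time (x , i) <? s) lt)) eq
  ... | ()

  early-mono : ∀ {s t} x i → s ≤ t → early s x i ≡ true → early t x i ≡ true
  early-mono x i s≤t eq = dec-true (_ <? _) (≤-trans (early⇒< _ x i eq) s≤t)

  late-mono : ∀ {s t} x i → s ≤ t → early t x i ≡ false → early s x i ≡ false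
  late-mono x i s≤t eq = dec-false (_ <? _) (λ lt → late⇒≮ _ x i eq (≤-trans lt s≤t))

  IsCut : ℕ → Vertex × Vertex → Set
  IsCut s ((x , i) , (y , j)) = Box _~_ _≈_ (x , i) (y , j) × early s x i ≡ true × early s y j ≡ false

  startColumn : Vertex × Vertex → V
  startColumn = proj₁ ∘ proj₁

  startRow : Vertex × Vertex → Fin p
  startRow = proj₂ ∘ proj₁

  -- At time s the columns in P carry h * p cut edges. The p columns with an early vertex keep one at all
  -- later times, and the p columns with a late vertex had one at all earlier times: this is what lets
  -- expansions found at different times be combined.
  record Expansion (P : V → Set) (h : ℕ) : Set where
    field
      s           : ℕ
      ins outs    : List V
      ins!        : Unique ins
      outs!       : Unique outs
      p≤∣ins∣     : p ≤ length ins
      p≤∣outs∣    : p ≤ length outs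
      ins-early   : All (λ x → P x × ∃ λ i → early s x i ≡ true) ins
      outs-late   : All (λ x → P x × ∃ λ i → early s x i ≡ false) outs
      cuts        : List (Vertex × Vertex)
      cuts!       : Unique cuts
      hp≤∣cuts∣   : h * p ≤ length cuts
      cuts-valid  : All (λ e → IsCut s e × P (startColumn e)) cuts

  -- Edges with distinct images under `g` are distinct. This is used for edges picked one per row
  -- (`startRow`) or one per column (`startColumn`).
  unique-via : {A : Set} (g : Vertex × Vertex → A) {Q : Vertex × Vertex → Set} {xs : List A} → Unique xs → p ≤ length xs →
               All (λ x → ∃ λ e → g e ≡ x × Q e) xs → ∃ λ es → Unique es × p ≤ length es × All Q es
  unique-via g xs! p≤ fibres with choose-fibres g fibres
  ... | es , refl , qs = es , Uniqueₚ.map⁻ xs! , subst (p ≤_) (length-map g es) p≤ , qs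

  module _ (path-linked : ∀ i j → Linked _≈_ (λ _ → ⊤) i j) where

    column-cut : ∀ s x i j → early s x i ≡ true → early s x j ≡ false → CutEdge _≈_ (λ _ → ⊤) (early s x)
    column-cut s x i j i-in j-out with path-linked i j (early s x)
    ... | inj₂ e  = e
    ... | inj₁ eq with trans (≡-sym i-in) (trans eq j-out)
    ...   | ()

    -- Either every row has a cut edge in R, or some row is constant on all the listed columns; in the
    -- latter case all columns of xs, or all columns of ys, are bichromatic.
    new-cuts : ∀ {R : V → Set} {r s xs ys} → Unique xs → Unique ys → p ≤ length xs → p ≤ length ys →
               All (λ x → (R x × Linked _~_ R r x) × ∃ λ i → early s x i ≡ true) xs →
               All (λ y → (R y × Linked _~_ R r y) × ∃ λ i → early s y i ≡ false) ys →
               ∃ λ es → Unique es × p ≤ length es × All (λ e → IsCut s e × R (startColumn e)) es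
    new-cuts {R} {r} {s} {xs} {ys} xs! ys! p≤xs p≤ys xs-early ys-late with all⊎any rows
      where
      row : Fin p → V → Bool
      row i x = early s x i
      rows : ∀ i → CutEdge _~_ R (row i) ⊎ All (λ x → row i r ≡ row i x) (xs ++ ys)
      rows i = linked-all (Allₚ.++⁺ (All.map (proj₂ ∘ proj₁) xs-early) (All.map (proj₂ ∘ proj₁) ys-late)) (row i)
    ... | inj₁ row-cut = unique-via startRow (Uniqueₚ.allFin⁺ p) (≤-reflexive (≡-sym (length-tabulate id)))
                           (All.tabulate λ {i} _ → in-row i (row-cut i))
      where
      in-row : ∀ i → CutEdge _~_ R (λ x → early s x i) → ∃ λ e → startRow e ≡ i × IsCut s e × R (startColumn e)
      in-row i (cutEdge {x} {y} x~y Rx x-in y-out) =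
        ((x , i) , (y , i)) , refl , (inj₁ (refl , x~y) , x-in , y-out) , Rx
    ... | inj₂ (i , same) = by-colour (early s r i) refl
      where
      in-column : ∀ {x} → R x → CutEdge _≈_ (λ _ → ⊤) (early s x) →
                  ∃ λ e → startColumn e ≡ x × IsCut s e × R (startColumn e)
      in-column {x} Rx (cutEdge {i} {j} i≈j _ i-in j-out) =
        ((x , i) , (x , j)) , refl , (inj₂ (refl , i≈j) , i-in , j-out) , Rx
      by-colour : ∀ b → early s r i ≡ b → ∃ λ es → Unique es × p ≤ length es × All (λ e → IsCut s e × R (startColumn e)) es
      -- Row `i` has the colour of `r` on all listed columns. If `r` is early there, each column of
      -- `ys` meets both colours, since it also has a late vertex; if `r` is late, the same holds
      -- for `xs`.
      by-colour true  r-in  = unique-via startColumn ys! p≤ys (All.zipWith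
        (λ { {y} (eq , (Ry , _) , j , y-out) → in-column Ry (column-cut s y i j (trans (≡-sym eq) r-in) y-out) })
        (Allₚ.++⁻ʳ xs same , ys-late))
      by-colour false r-out = unique-via startColumn xs! p≤xs (All.zipWith
        (λ { {x} (eq , (Rx , _) , j , x-in) → in-column Rx (column-cut s x j i x-in (trans (≡-sym eq) r-out)) })
        (Allₚ.++⁻ˡ xs same , xs-early))

    open Expansion

    -- The time of `x` is the middle one: by then the early vertices of `y` are still early and the
    -- late vertices of `z` are already late. So `new-cuts` applies outside `X`, while `x` keeps its
    -- own cuts and supplies the columns of the result.
    expand-middle : ∀ {P X Y Z : V → Set} {h} (r : V) → (∀ {v} → X v → P v) →
              (let R = λ v → P v × ¬ X v) →
              (∀ {v} → Y v → R v × Linked _~_ R r v) → (∀ {v} → Z v → R v × Linked _~_ R r v) →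
              (x : Expansion X h) (y : Expansion Y h) (z : Expansion Z h) → s y ≤ s x → s x ≤ s z →
              Expansion P (suc h)
    expand-middle {P} {X} {h = h} r X⊆P Y-linked Z-linked x y z sy≤sx sx≤sz
      with new-cuts {s = s x} (ins! y) (outs! z) (p≤∣ins∣ y) (p≤∣outs∣ z)
             (All.map (λ {v} (Yv , i , e) → Y-linked Yv , i , early-mono v i sy≤sx e) (ins-early y))
             (All.map (λ {v} (Zv , i , e) → Z-linked Zv , i , late-mono v i sx≤sz e) (outs-late z))
    ... | es , es! , p≤es , es-valid = record
      { s          = s x
      ; ins        = ins x
      ; outs       = outs x
      ; ins!       = ins! x
      ; outs!      = outs! x
      ; p≤∣ins∣    = p≤∣ins∣ x
      ; p≤∣outs∣   = p≤∣outs∣ x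
      ; ins-early  = All.map (λ (Xv , e) → X⊆P Xv , e) (ins-early x)
      ; outs-late  = All.map (λ (Xv , e) → X⊆P Xv , e) (outs-late x)
      ; cuts       = es ++ cuts x
      -- New edges start outside `X` and old ones inside, so the two lists are disjoint.
      ; cuts!      = Uniqueₚ.++⁺ es! (cuts! x)
                       (λ (e∈es , e∈x) → proj₂ (proj₂ (All.lookup es-valid e∈es)) (proj₂ (All.lookup (cuts-valid x) e∈x)))
      ; hp≤∣cuts∣  = ≤-trans (+-mono-≤ p≤es (hp≤∣cuts∣ x)) (≤-reflexive (≡-sym (length-++ es)))
      ; cuts-valid = Allₚ.++⁺ (All.map (λ (c , Pv , _) → c , Pv) es-valid)
                              (All.map (λ (c , Xv) → c , X⊆P Xv) (cuts-valid x))
      }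

    -- Any of the three pieces may have the median time, so for each of them the other two must be
    -- linked to a common vertex in its complement.
    expand-median : ∀ {P A B C : V → Set} {h} →
      (∀ {v} → A v → P v) → (∀ {v} → B v → P v) → (∀ {v} → C v → P v) →
      (let Rest = λ X v → P v × ¬ X v) →
      (∃ λ r → (∀ {v} → B v ⊎ C v → Rest A v × Linked _~_ (Rest A) r v)) →
      (∃ λ r → (∀ {v} → A v ⊎ C v → Rest B v × Linked _~_ (Rest B) r v)) →
      (∃ λ r → (∀ {v} → A v ⊎ B v → Rest C v × Linked _~_ (Rest C) r v)) →
      Expansion A h → Expansion B h → Expansion C h → Expansion P (suc h)
    expand-median A⊆P B⊆P C⊆P (rA , lA) (rB , lB) (rC , lC) a b c
      with ≤-total (s a) (s b) | ≤-total (s b) (s c) | ≤-total (s a) (s c)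
    ... | inj₁ a≤b | inj₁ b≤c | _        = expand-middle rB B⊆P (lB ∘ inj₁) (lB ∘ inj₂) b a c a≤b b≤c
    ... | inj₁ a≤b | inj₂ c≤b | inj₁ a≤c = expand-middle rC C⊆P (lC ∘ inj₁) (lC ∘ inj₂) c a b a≤c c≤b
    ... | inj₁ a≤b | inj₂ c≤b | inj₂ c≤a = expand-middle rA A⊆P (lA ∘ inj₂) (lA ∘ inj₁) a c b c≤a a≤b
    ... | inj₂ b≤a | _        | inj₁ a≤c = expand-middle rA A⊆P (lA ∘ inj₁) (lA ∘ inj₂) a b c b≤a a≤c
    ... | inj₂ b≤a | inj₁ b≤c | inj₂ c≤a = expand-middle rC C⊆P (lC ∘ inj₂) (lC ∘ inj₁) c b a b≤c c≤a
    ... | inj₂ b≤a | inj₂ c≤b | inj₂ c≤a = expand-middle rB B⊆P (lB ∘ inj₂) (lB ∘ inj₁) b c a c≤b b≤a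

  -- With no cut edges to provide, it suffices to look at row `zero`: at its median time `p` columns
  -- are early there and `p` others are late.
  expand-base : (∀ {x y} → time (x , zero) ≡ time (y , zero) → x ≡ y) →
         ∀ {P : V → Set} {xs} → Unique xs → All P xs → p + p ≤ length xs → Expansion P 0
  expand-base injective {P} {xs} xs! xs∈P 2p≤ with median (λ x → time (x , zero)) injective xs! p 2p≤
  ... | s , p≤below , p≤above = record
    { s          = s
    ; ins        = below f s xs
    ; outs       = above f s xs
    ; ins!       = Uniqueₚ.filter⁺ (below? f s) xs!
    ; outs!      = Uniqueₚ.filter⁺ (∁? (below? f s)) xs!
    ; p≤∣ins∣    = p≤below
    ; p≤∣outs∣   = p≤above
    ; ins-early  = All.zipWith (λ (Px , lt) → Px , zero , dec-true (_ <? s) lt)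
                     (Allₚ.filter⁺ (below? f s) xs∈P , Allₚ.all-filter (below? f s) xs)
    ; outs-late  = All.zipWith (λ (Px , ge) → Px , zero , dec-false (_ <? s) ge)
                     (Allₚ.filter⁺ (∁? (below? f s)) xs∈P , Allₚ.all-filter (∁? (below? f s)) xs)
    ; cuts       = []
    ; cuts!      = []
    ; hp≤∣cuts∣  = z≤n
    ; cuts-valid = []
    }
    where
    f : V → ℕ
    f x = time (x , zero)

-- Binary trees, paths and their product

data BinTree : Set where
  leaf : BinTree
  two  : BinTree → BinTree → BinTree

data Pos : BinTree → Set where
  root : ∀ {t} → Pos t
  inl  : ∀ {l r} → Pos l → Pos (two l r)
  inr  : ∀ {l r} → Pos r → Pos (two l r)

-- The parent. The default `root` applies when `x` is the root of its own subtree.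
up : ∀ {t} → Pos t → Maybe (Pos t)
up root    = nothing
up (inl x) = just (maybe′ inl root (up x))
up (inr x) = just (maybe′ inr root (up x))

_~_ : ∀ {t} → Pos t → Pos t → Set
x ~ y = up x ≡ just y ⊎ up y ≡ just x

~-inl : ∀ {l r} {x y : Pos l} → x ~ y → inl {r = r} x ~ inl y
~-inl (inj₁ eq) = inj₁ (cong (just ∘ maybe′ inl root) eq)
~-inl (inj₂ eq) = inj₂ (cong (just ∘ maybe′ inl root) eq)

~-inr : ∀ {l r} {x y : Pos r} → x ~ y → inr {l = l} x ~ inr y
~-inr (inj₁ eq) = inj₁ (cong (just ∘ maybe′ inr root) eq)
~-inr (inj₂ eq) = inj₂ (cong (just ∘ maybe′ inr root) eq)

root-linked : ∀ {t} (x : Pos t) → Linked _~_ (λ _ → ⊤) root x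
root-linked root    = linked-refl
root-linked (inl x) = linked-trans (linked-edge swap (inj₂ refl) tt tt) (linked-map inl ~-inl id (root-linked x))
root-linked (inr x) = linked-trans (linked-edge swap (inj₂ refl) tt tt) (linked-map inr ~-inr id (root-linked x))

kids : ∀ {t} → Pos t → List (Pos t)
kids {leaf}    root    = []
kids {two l r} root    = inl root ∷ inr root ∷ []
kids           (inl x) = map inl (kids x)
kids           (inr x) = map inr (kids x)

length-kids : ∀ {t} (x : Pos t) → length (kids x) ≤ 2
length-kids {leaf}    root    = z≤n
length-kids {two l r} root    = ≤-refl
length-kids           (inl x) = ≤-trans (≤-reflexive (length-map inl (kids x))) (length-kids x)
length-kids           (inr x) = ≤-trans (≤-reflexive (length-map inr (kids x))) (length-kids x)

∈-kids⁻ : ∀ {t} (x : Pos t) {y} → y ∈ kids x → up y ≡ just x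
∈-kids⁻ {two l r} root (here refl)         = refl
∈-kids⁻ {two l r} root (there (here refl)) = refl
∈-kids⁻ (inl x) y∈ with ∈-map⁻ inl y∈
... | z , z∈ , refl = cong (just ∘ maybe′ inl root) (∈-kids⁻ x z∈)
∈-kids⁻ (inr x) y∈ with ∈-map⁻ inr y∈
... | z , z∈ , refl = cong (just ∘ maybe′ inr root) (∈-kids⁻ x z∈)

∈-kids⁺ : ∀ {t} (y : Pos t) {x} → up y ≡ just x → y ∈ kids x
∈-kids⁺ (inl y) eq with up y in up-y
∈-kids⁺ (inl root) refl | nothing = here refl
∈-kids⁺ (inl y)    refl | just x  = ∈-map⁺ inl (∈-kids⁺ y up-y)
∈-kids⁺ (inr y) eq with up y in up-y
∈-kids⁺ (inr root) refl | nothing = there (here refl)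
∈-kids⁺ (inr y)    refl | just x  = ∈-map⁺ inr (∈-kids⁺ y up-y)

treeNbrs : ∀ {t} → Pos t → List (Pos t)
treeNbrs x = fromMaybe (up x) ++ kids x

∈-fromMaybe⁻ : {A : Set} {x : A} (mx : Maybe A) → x ∈ fromMaybe mx → mx ≡ just x
∈-fromMaybe⁻ (just x) (here refl) = refl

length-fromMaybe : {A : Set} (mx : Maybe A) → length (fromMaybe mx) ≤ 1
length-fromMaybe (just x) = ≤-refl
length-fromMaybe nothing  = z≤n

∈-treeNbrs⁻ : ∀ {t} {x y : Pos t} → y ∈ treeNbrs x → x ~ y
∈-treeNbrs⁻ {x = x} y∈ with ∈-++⁻ (fromMaybe (up x)) y∈
... | inj₁ y∈up   = inj₁ (∈-fromMaybe⁻ (up x) y∈up)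
... | inj₂ y∈kids = inj₂ (∈-kids⁻ x y∈kids)

∈-treeNbrs⁺ : ∀ {t} {x y : Pos t} → x ~ y → y ∈ treeNbrs x
∈-treeNbrs⁺ {x = x} {y} (inj₁ eq) = ∈-++⁺ˡ (subst (λ m → y ∈ fromMaybe m) (≡-sym eq) (here refl))
∈-treeNbrs⁺ {x = x} {y} (inj₂ eq) = ∈-++⁺ʳ (fromMaybe (up x)) (∈-kids⁺ y eq)

length-treeNbrs : ∀ {t} (x : Pos t) → length (treeNbrs x) ≤ 3
length-treeNbrs x = ≤-trans (≤-reflexive (length-++ (fromMaybe (up x))))
                            (+-mono-≤ (length-fromMaybe (up x)) (length-kids x))

-- The number of non-root nodes, which is the field `m` of a `Tree`. It makes `order t` a successor
-- by definition, so that the root can have index `zero`.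
pred-order : BinTree → ℕ
pred-order leaf      = 0
pred-order (two l r) = suc (pred-order l) + suc (pred-order r)

order : BinTree → ℕ
order t = suc (pred-order t)

-- Preorder numbering, so that a node comes after its parent.
index : ∀ {t} → Pos t → Fin (order t)
index           root    = zero
index {two l r} (inl x) = suc (index x ↑ˡ order r)
index {two l r} (inr x) = suc (order l ↑ʳ index x)

node : ∀ t → Fin (order t) → Pos t
node t         zero    = root
node (two l r) (suc i) = [ inl ∘ node l , inr ∘ node r ]′ (splitAt (order l) i)

node-index : ∀ {t} (x : Pos t) → node t (index x) ≡ x
node-index root = refl
node-index {two l r} (inl x) rewrite splitAt-↑ˡ (order l) (index x) (order r) = cong inl (node-index x)
node-index {two l r} (inr x) rewrite splitAt-↑ʳ (order l) (order r) (index x) = cong inr (node-index x)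

index-node : ∀ t (i : Fin (order t)) → index (node t i) ≡ i
index-node t zero = refl
index-node (two l r) (suc i) with splitAt (order l) i in eq
... | inj₁ j = cong suc (trans (cong (_↑ˡ order r) (index-node l j)) (splitAt⁻¹-↑ˡ eq))
... | inj₂ j = cong suc (trans (cong (order l ↑ʳ_) (index-node r j)) (splitAt⁻¹-↑ʳ eq))

-- This yields `par-lt` for the decomposition tree and also excludes loops in `_~_`.
index-up : ∀ {t} (x : Pos t) {y} → up x ≡ just y → toℕ (index y) < toℕ (index x)
index-up (inl x) eq with up x in up-x
index-up (inl x) refl | nothing = s≤s z≤n
index-up {two l r} (inl x) refl | just y
  rewrite toℕ-↑ˡ (index x) (order r) | toℕ-↑ˡ (index y) (order r) = s≤s (index-up x up-x)
index-up (inr x) eq with up x in up-x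
index-up (inr x) refl | nothing = s≤s z≤n
index-up {two l r} (inr x) refl | just y
  rewrite toℕ-↑ʳ (order l) (index x) | toℕ-↑ʳ (order l) (index y) = s≤s (+-monoʳ-< (order l) (index-up x up-x))

~-irrefl : ∀ {t} {x : Pos t} → ¬ x ~ x
~-irrefl {x = x} (inj₁ eq) = <-irrefl refl (index-up x eq)
~-irrefl {x = x} (inj₂ eq) = <-irrefl refl (index-up x eq)

nodes : ∀ t → List (Pos t)
nodes t = map (node t) (allFin (order t))

nodes! : ∀ t → Unique (nodes t)
nodes! t = Uniqueₚ.map⁺ (λ {i} {j} eq → trans (≡-sym (index-node t i)) (trans (cong index eq) (index-node t j)))
                        (Uniqueₚ.allFin⁺ (order t))

length-nodes : ∀ t → length (nodes t) ≡ order t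
length-nodes t = trans (length-map (node t) (allFin (order t))) (length-tabulate id)

-- Paths

_≈_ : ∀ {p} → Fin p → Fin p → Set
i ≈ j = toℕ i ≡ suc (toℕ j) ⊎ toℕ j ≡ suc (toℕ i)

≈-suc : ∀ {p} {i j : Fin p} → i ≈ j → suc i ≈ suc j
≈-suc (inj₁ eq) = inj₁ (cong suc eq)
≈-suc (inj₂ eq) = inj₂ (cong suc eq)

≈-irrefl : ∀ {p} {i : Fin p} → ¬ i ≈ i
≈-irrefl (inj₁ eq) = 1+n≢n (≡-sym eq)
≈-irrefl (inj₂ eq) = 1+n≢n (≡-sym eq)

zero-linked : ∀ {q} (i : Fin (suc q)) → Linked _≈_ (λ _ → ⊤) zero i
zero-linked zero = linked-refl
zero-linked {suc q} (suc i) =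
  linked-trans (linked-edge swap (inj₂ refl) tt tt) (linked-map suc ≈-suc id (zero-linked i))

path-linked : ∀ {q} (i j : Fin (suc q)) → Linked _≈_ (λ _ → ⊤) i j
path-linked i j = linked-trans (linked-sym (zero-linked i)) (zero-linked j)

lower upper : ∀ {p} → Fin p → List (Fin p)
lower zero    = []
lower (suc i) = [ inject₁ i ]
upper {suc zero}    zero    = []
upper {suc (suc p)} zero    = [ suc zero ]
upper               (suc i) = map suc (upper i)

∈-lower⁻ : ∀ {p} (i : Fin p) {j} → j ∈ lower i → toℕ i ≡ suc (toℕ j)
∈-lower⁻ (suc i) (here refl) = cong suc (≡-sym (toℕ-inject₁ i))

∈-lower⁺ : ∀ {p} (i : Fin p) {j} → toℕ i ≡ suc (toℕ j) → j ∈ lower i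
∈-lower⁺ (suc i) eq = here (toℕ-injective (trans (≡-sym (suc-injective eq)) (≡-sym (toℕ-inject₁ i))))

∈-upper⁻ : ∀ {p} (i : Fin p) {j} → j ∈ upper i → toℕ j ≡ suc (toℕ i)
∈-upper⁻ {suc (suc p)} zero (here refl) = refl
∈-upper⁻ (suc i) j∈ with ∈-map⁻ suc j∈
... | k , k∈ , refl = cong suc (∈-upper⁻ i k∈)

∈-upper⁺ : ∀ {p} (i : Fin p) {j} → toℕ j ≡ suc (toℕ i) → j ∈ upper i
∈-upper⁺ {suc (suc p)} zero {suc zero} eq = here refl
∈-upper⁺ (suc i) {suc j} eq = ∈-map⁺ suc (∈-upper⁺ i (suc-injective eq))

length-lower : ∀ {p} (i : Fin p) → length (lower i) ≤ 1
length-lower zero    = z≤n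
length-lower (suc i) = ≤-refl

length-upper : ∀ {p} (i : Fin p) → length (upper i) ≤ 1
length-upper {suc zero}    zero    = z≤n
length-upper {suc (suc p)} zero    = ≤-refl
length-upper               (suc i) = ≤-trans (≤-reflexive (length-map suc (upper i))) (length-upper i)

pathNbrs : ∀ {p} → Fin p → List (Fin p)
pathNbrs i = lower i ++ upper i

∈-pathNbrs⁻ : ∀ {p} {i j : Fin p} → j ∈ pathNbrs i → i ≈ j
∈-pathNbrs⁻ {i = i} j∈ with ∈-++⁻ (lower i) j∈
... | inj₁ j∈lower = inj₁ (∈-lower⁻ i j∈lower)
... | inj₂ j∈upper = inj₂ (∈-upper⁻ i j∈upper)

∈-pathNbrs⁺ : ∀ {p} {i j : Fin p} → i ≈ j → j ∈ pathNbrs i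
∈-pathNbrs⁺ {i = i} (inj₁ eq) = ∈-++⁺ˡ (∈-lower⁺ i eq)
∈-pathNbrs⁺ {i = i} (inj₂ eq) = ∈-++⁺ʳ (lower i) (∈-upper⁺ i eq)

length-pathNbrs : ∀ {p} (i : Fin p) → length (pathNbrs i) ≤ 2
length-pathNbrs i = ≤-trans (≤-reflexive (length-++ (lower i))) (+-mono-≤ (length-lower i) (length-upper i))

-- Subsets given by lists

∣p∪q∣≤∣p∣+∣q∣ : ∀ {n} (P Q : Subset n) → ∣ P ∪ Q ∣ ≤ ∣ P ∣ + ∣ Q ∣
∣p∪q∣≤∣p∣+∣q∣ []          []          = z≤n
∣p∪q∣≤∣p∣+∣q∣ (false ∷ P) (false ∷ Q) = ∣p∪q∣≤∣p∣+∣q∣ P Q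
∣p∪q∣≤∣p∣+∣q∣ (true  ∷ P) (false ∷ Q) = s≤s (∣p∪q∣≤∣p∣+∣q∣ P Q)
∣p∪q∣≤∣p∣+∣q∣ (false ∷ P) (true  ∷ Q) = ≤-trans (s≤s (∣p∪q∣≤∣p∣+∣q∣ P Q)) (≤-reflexive (≡-sym (+-suc ∣ P ∣ ∣ Q ∣)))
∣p∪q∣≤∣p∣+∣q∣ (true  ∷ P) (true  ∷ Q) = s≤s (≤-trans (∣p∪q∣≤∣p∣+∣q∣ P Q) (+-monoʳ-≤ ∣ P ∣ (n≤1+n ∣ Q ∣)))

fromList : ∀ {n} → List (Fin n) → Subset n
fromList []       = Subset.⊥
fromList (x ∷ xs) = ⁅ x ⁆ ∪ fromList xs

∈-fromList⁺ : ∀ {n} {x : Fin n} {xs} → x ∈ xs → x Subset.∈ fromList xs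
∈-fromList⁺ (here refl) = Subsetₚ.x∈p∪q⁺ (inj₁ (Subsetₚ.x∈⁅x⁆ _))
∈-fromList⁺ (there x∈)  = Subsetₚ.x∈p∪q⁺ (inj₂ (∈-fromList⁺ x∈))

∈-fromList⁻ : ∀ {n} {x : Fin n} xs → x Subset.∈ fromList xs → x ∈ xs
∈-fromList⁻ []       x∈ = contradiction x∈ Subsetₚ.∉⊥
∈-fromList⁻ (y ∷ xs) x∈ with Subsetₚ.x∈p∪q⁻ ⁅ y ⁆ (fromList xs) x∈
... | inj₁ x∈y  = here (Subsetₚ.x∈⁅y⁆⇒x≡y y x∈y)
... | inj₂ x∈xs = there (∈-fromList⁻ xs x∈xs)

∣fromList∣≤ : ∀ {n} (xs : List (Fin n)) → ∣ fromList xs ∣ ≤ length xs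
∣fromList∣≤ {n} []  = ≤-reflexive (Subsetₚ.∣⊥∣≡0 n)
∣fromList∣≤ (x ∷ xs) = ≤-trans (∣p∪q∣≤∣p∣+∣q∣ ⁅ x ⁆ (fromList xs))
                               (+-mono-≤ (≤-reflexive (Subsetₚ.∣⁅x⁆∣≡1 x)) (∣fromList∣≤ xs))

-- The product graph and its tree decomposition

Box-sym : ∀ {t p} {u v : Pos t × Fin p} → Box _~_ _≈_ u v → Box _~_ _≈_ v u
Box-sym (inj₁ (refl , x~y)) = inj₁ (refl , swap x~y)
Box-sym (inj₂ (refl , i≈j)) = inj₂ (refl , swap i≈j)

Box-irrefl : ∀ {t p} {v : Pos t × Fin p} → ¬ Box _~_ _≈_ v v
Box-irrefl (inj₁ (_ , x~x)) = ~-irrefl x~x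
Box-irrefl (inj₂ (_ , i≈i)) = ≈-irrefl i≈i

module Grid (t : BinTree) (p : ℕ) where

  vertex : Pos t × Fin p → Fin (order t * p)
  vertex (x , i) = combine (index x) i

  column : Fin (order t * p) → Pos t
  column v = node t (proj₁ (remQuot p v))

  row : Fin (order t * p) → Fin p
  row v = proj₂ (remQuot {order t} p v)

  coord : Fin (order t * p) → Pos t × Fin p
  coord v = column v , row v

  vertex-coord : ∀ v → vertex (coord v) ≡ v
  vertex-coord v = trans (cong (λ j → combine j (row v)) (index-node t (proj₁ (remQuot p v)))) (combine-remQuot {order t} p v)

  coord-vertex : ∀ u → coord (vertex u) ≡ u
  coord-vertex (x , i) = trans (cong (λ ji → node t (proj₁ ji) , proj₂ ji) (remQuot-combine (index x) i))
                               (cong (_, i) (node-index x))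

  vertex-injective : ∀ {u v} → vertex u ≡ vertex v → u ≡ v
  vertex-injective {u} {v} eq = trans (≡-sym (coord-vertex u)) (trans (cong coord eq) (coord-vertex v))

  nbrs : Fin (order t * p) → List (Fin (order t * p))
  nbrs v = map (λ y → vertex (y , row v)) (treeNbrs (column v)) ++ map (λ j → vertex (column v , j)) (pathNbrs (row v))

  -- At most three neighbours come from the tree and at most two from the path.
  length-nbrs : ∀ v → length (nbrs v) ≤ 5
  length-nbrs v = ≤-trans (≤-reflexive (trans (length-++ (map (λ y → vertex (y , row v)) (treeNbrs (column v))))
      (cong₂ _+_ (length-map _ (treeNbrs (column v))) (length-map _ (pathNbrs (row v))))))
    (+-mono-≤ (length-treeNbrs (column v)) (length-pathNbrs (row v)))

  ∈-nbrs⁻ : ∀ {u v} → u ∈ nbrs v → Box _~_ _≈_ (coord v) (coord u)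
  ∈-nbrs⁻ {u} {v} u∈ with ∈-++⁻ (map (λ y → vertex (y , row v)) (treeNbrs (column v))) u∈
  ... | inj₁ u∈tree with ∈-map⁻ (λ y → vertex (y , row v)) u∈tree
  ...   | y , y∈ , refl = subst (Box _~_ _≈_ (coord v)) (≡-sym (coord-vertex _)) (inj₁ (refl , ∈-treeNbrs⁻ y∈))
  ∈-nbrs⁻ {u} {v} u∈ | inj₂ u∈path with ∈-map⁻ (λ j → vertex (column v , j)) u∈path
  ...   | j , j∈ , refl = subst (Box _~_ _≈_ (coord v)) (≡-sym (coord-vertex _)) (inj₂ (refl , ∈-pathNbrs⁻ j∈))

  box⇒∈-nbrs : ∀ {v y j} → Box _~_ _≈_ (coord v) (y , j) → vertex (y , j) ∈ nbrs v
  box⇒∈-nbrs (inj₁ (refl , x~y)) = ∈-++⁺ˡ (∈-map⁺ _ (∈-treeNbrs⁺ x~y))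
  box⇒∈-nbrs {v} (inj₂ (refl , i≈j)) = ∈-++⁺ʳ (map (λ y → vertex (y , row v)) (treeNbrs (column v))) (∈-map⁺ _ (∈-pathNbrs⁺ i≈j))

  ∈-nbrs⁺ : ∀ {u v} → Box _~_ _≈_ (coord v) (coord u) → u ∈ nbrs v
  ∈-nbrs⁺ {u} {v} b = subst (_∈ nbrs v) (vertex-coord u) (box⇒∈-nbrs b)

  grid : Graph (order t * p)
  grid = record
    { nbr    = fromList ∘ nbrs
    ; sym    = λ {u} {v} u∈ → ∈-fromList⁺ (∈-nbrs⁺ {v} {u} (Box-sym (∈-nbrs⁻ {u} {v} (∈-fromList⁻ (nbrs v) u∈))))
    ; irrefl = λ {v} v∈ → Box-irrefl (∈-nbrs⁻ {v} {v} (∈-fromList⁻ (nbrs v) v∈))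
    }

  adj⁻ : ∀ {u v} → Adj grid u v → Box _~_ _≈_ (coord u) (coord v)
  adj⁻ {u} {v} a = ∈-nbrs⁻ {v} {u} (∈-fromList⁻ (nbrs u) a)

  adj⁺ : ∀ {u v} → Box _~_ _≈_ u v → Adj grid (vertex u) (vertex v)
  adj⁺ {u} {v} b = ∈-fromList⁺ (box⇒∈-nbrs {vertex u} (subst (λ w → Box _~_ _≈_ w v) (≡-sym (coord-vertex u)) b))

  maxDegree≤5 : MaxDegree≤ grid 5
  maxDegree≤5 v = ≤-trans (∣fromList∣≤ (nbrs v)) (length-nbrs v)

  tree : Tree
  tree = record
    { m      = pred-order t
    -- A node of positive index has a parent; the default `zero` makes the map total.
    ; par    = λ i → maybe′ index zero (up (node t (suc i)))
    ; par-lt = par-lt′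
    }
    where
    par-lt′ : ∀ i → toℕ (maybe′ index zero (up (node t (suc i)))) ≤ toℕ i
    par-lt′ i with up (node t (suc i)) in eq
    ... | nothing = z≤n
    ... | just y  = ≤-pred (subst (λ j → toℕ (index y) < toℕ j) (index-node t (suc i)) (index-up (node t (suc i)) eq))

  up-edge : ∀ a {y} → up (node t a) ≡ just y → ∃ λ i → a ≡ suc i × index y ≡ par tree i
  up-edge zero    ()
  up-edge (suc i) eq = i , refl , cong (maybe′ index zero) (≡-sym eq)

  columnVertices : Pos t → List (Fin (order t * p))
  columnVertices x = map (λ i → vertex (x , i)) (allFin p)

  length-columnVertices : ∀ x → length (columnVertices x) ≡ p
  length-columnVertices x = trans (length-map _ (allFin p)) (length-tabulate id)

  ∈-columnVertices⁺ : ∀ v → v ∈ columnVertices (column v)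
  ∈-columnVertices⁺ v = subst (_∈ columnVertices (column v)) (vertex-coord v) (∈-map⁺ _ (∈-allFin (row v)))

  ∈-columnVertices⁻ : ∀ {v x} → v ∈ columnVertices x → column v ≡ x
  ∈-columnVertices⁻ {v} {x} v∈ with ∈-map⁻ (λ i → vertex (x , i)) v∈
  ... | i , _ , refl = cong proj₁ (coord-vertex (x , i))

  bagList : Pos t → List (Fin (order t * p))
  bagList x = columnVertices x ++ maybe′ columnVertices [] (up x)

  ∈-bagList⁻ : ∀ {v} x → v ∈ bagList x → column v ≡ x ⊎ up x ≡ just (column v)
  ∈-bagList⁻ x v∈ with ∈-++⁻ (columnVertices x) v∈
  ... | inj₁ v∈x = inj₁ (∈-columnVertices⁻ v∈x)
  ... | inj₂ v∈up with up x
  ...   | just y = inj₂ (cong just (≡-sym (∈-columnVertices⁻ v∈up)))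

  ∈-bagList⁺ : ∀ {v} x → column v ≡ x ⊎ up x ≡ just (column v) → v ∈ bagList x
  ∈-bagList⁺ {v} x (inj₁ refl) = ∈-++⁺ˡ (∈-columnVertices⁺ v)
  ∈-bagList⁺ {v} x (inj₂ eq)   = ∈-++⁺ʳ (columnVertices x) (subst (λ m → v ∈ maybe′ columnVertices [] m) (≡-sym eq) (∈-columnVertices⁺ v))

  length-bagList : ∀ x → length (bagList x) ≤ p + p
  length-bagList x = ≤-trans (≤-reflexive (length-++ (columnVertices x)))
                             (+-mono-≤ (≤-reflexive (length-columnVertices x)) (parent-part (up x)))
    where
    parent-part : ∀ my → length (maybe′ columnVertices [] my) ≤ p
    parent-part nothing  = z≤n
    parent-part (just y) = ≤-reflexive (length-columnVertices y)

  treewidth : ∀ k → p + p ≤ suc k → TreewidthAtMost grid k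
  treewidth k 2p≤ = record
    { tree       = tree
    ; bag        = bag
    ; bag-size   = λ a → ≤-trans (∣fromList∣≤ (bagList (node t a))) (≤-trans (length-bagList (node t a)) 2p≤)
    ; cover-vert = λ v → index (column v) , home v
    ; cover-edge = λ u v u~v → cover u v (adj⁻ {u} {v} u~v)
    ; connected  = λ v a b v∈a v∈b → walk v a b (∈-bag⁻ a v∈a) (∈-bag⁻ b v∈b)
    }
    where
    bag : Node tree → Subset (order t * p)
    bag a = fromList (bagList (node t a))

    ∈-bag⁻ : ∀ {v} a → v Subset.∈ bag a → column v ≡ node t a ⊎ up (node t a) ≡ just (column v)
    ∈-bag⁻ a v∈ = ∈-bagList⁻ (node t a) (∈-fromList⁻ (bagList (node t a)) v∈)

    ∈-bag⁺ : ∀ {v} x → column v ≡ x ⊎ up x ≡ just (column v) → v Subset.∈ bag (index x)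
    ∈-bag⁺ {v} x h = ∈-fromList⁺ (subst (λ y → v ∈ bagList y) (≡-sym (node-index x)) (∈-bagList⁺ x h))

    home : ∀ v → v Subset.∈ bag (index (column v))
    home v = ∈-bag⁺ (column v) (inj₁ refl)

    -- A tree edge lies in the bag of its child end, a path edge in the bag of its own column.
    cover : ∀ u v → Box _~_ _≈_ (coord u) (coord v) → ∃ λ a → u Subset.∈ bag a × v Subset.∈ bag a
    cover u v (inj₁ (_ , inj₁ eq)) = index (column u) , home u , ∈-bag⁺ (column u) (inj₂ eq)
    cover u v (inj₁ (_ , inj₂ eq)) = index (column v) , ∈-bag⁺ (column v) (inj₂ eq) , home v
    cover u v (inj₂ (eq , _))      = index (column v) , ∈-bag⁺ (column v) (inj₁ eq) , home v

    In : Fin (order t * p) → Node tree → Set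
    In v a = v Subset.∈ bag a

    module _ (v : Fin (order t * p)) where

      at : ∀ a → up (node t a) ≡ just (column v) → v Subset.∈ bag a
      at a eq = subst (λ b → v Subset.∈ bag b) (index-node t a) (∈-bag⁺ (node t a) (inj₂ eq))

      centre : ∀ {a} → column v ≡ node t a → index (column v) ≡ a
      centre {a} eq = trans (cong index eq) (index-node t a)

      -- The bags containing `v` are those of the node `column v` and of its children. They form a
      -- star, and every walk is routed through its centre.
      from-centre : ∀ b → column v ≡ node t b ⊎ up (node t b) ≡ just (column v) → WalkIn tree (In v) (index (column v)) b
      from-centre b (inj₁ eq) = subst (WalkIn tree (In v) (index (column v))) (centre eq) (here (home v))
      from-centre b (inj₂ eq) with up-edge b eq
      ... | i , b≡ , y≡ = step (home v) (i , inj₂ (b≡ , y≡)) (here (at b eq))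

      walk : ∀ a b → column v ≡ node t a ⊎ up (node t a) ≡ just (column v) →
             column v ≡ node t b ⊎ up (node t b) ≡ just (column v) → WalkIn tree (In v) a b
      walk a b (inj₁ eq) hb = subst (λ a → WalkIn tree (In v) a b) (centre eq) (from-centre b hb)
      walk a b (inj₂ eq) hb with up-edge a eq
      ... | i , a≡ , y≡ = step (at a eq) (i , inj₁ (a≡ , y≡)) (from-centre b hb)

-- Distant matchings from bounded degree

length-concatMap : {A B : Set} {f : A → List B} {d : ℕ} → (∀ x → length (f x) ≤ d) →
                   ∀ xs → length (concatMap f xs) ≤ length xs * d
length-concatMap f≤d [] = z≤n
length-concatMap {f = f} f≤d (x ∷ xs) =
  ≤-trans (≤-reflexive (length-++ (f x))) (+-mono-≤ (f≤d x) (length-concatMap f≤d xs))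

module Greedy {n : ℕ} (G : Graph n) (nbrs : Fin n → List (Fin n)) (Δ : ℕ)
              (nbrs-complete : ∀ {u v} → Adj G u v → v ∈ nbrs u)
              (length-nbrs : ∀ v → length (nbrs v) ≤ Δ) where

  -- Contains every vertex that is `Close` to `v`. Repetitions are allowed, as only an upper bound
  -- on the length is used.
  ball : Fin n → List (Fin n)
  ball v = v ∷ nbrs v ++ concatMap nbrs (nbrs v)

  ballBound : ℕ
  ballBound = suc (Δ + Δ * Δ)

  length-ball : ∀ v → length (ball v) ≤ ballBound
  length-ball v = s≤s (≤-trans (≤-reflexive (length-++ (nbrs v)))
    (+-mono-≤ (length-nbrs v) (≤-trans (length-concatMap length-nbrs (nbrs v)) (*-monoˡ-≤ Δ (length-nbrs v)))))

  close⇒∈-ball : ∀ {u v} → Close G u v → v ∈ ball u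
  close⇒∈-ball (inj₁ refl)       = here refl
  close⇒∈-ball (inj₂ (inj₁ u~v)) = there (∈-++⁺ˡ (nbrs-complete u~v))
  close⇒∈-ball {u} (inj₂ (inj₂ (w , u~w , w~v))) =
    there (∈-++⁺ʳ (nbrs u) (∈-concatMap⁺ nbrs (lose (nbrs-complete u~w) (nbrs-complete w~v))))

  edgesAt : Fin n → List (Edge n)
  edgesAt c = map (c ,_) (nbrs c)

  incident : Edge n → List (Edge n)
  incident (a , b) = concatMap edgesAt (ball a ++ ball b)

  -- `incident` lists the pairs whose first end is in one of the two balls; swapping them covers the
  -- pairs whose second end is.
  conflicts : Edge n → List (Edge n)
  conflicts e = incident e ++ map Product.swap (incident e)

  -- For `Δ = 5` a ball has at most 31 entries, so this is 62 * 5 + 62 * 5 = 620, whence the factor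
  -- 621.
  conflictBound : ℕ
  conflictBound = (ballBound + ballBound) * Δ + (ballBound + ballBound) * Δ

  length-conflicts : ∀ e → length (conflicts e) ≤ conflictBound
  length-conflicts e@(a , b) = ≤-trans (≤-reflexive (length-++ (incident e)))
      (+-mono-≤ length-incident (≤-trans (≤-reflexive (length-map Product.swap (incident e))) length-incident))
    where
    length-incident : length (incident e) ≤ (ballBound + ballBound) * Δ
    length-incident = ≤-trans
      (length-concatMap {f = edgesAt} (λ c → ≤-trans (≤-reflexive (length-map (c ,_) (nbrs c))) (length-nbrs c)) (ball a ++ ball b))
      (*-monoˡ-≤ Δ (≤-trans (≤-reflexive (length-++ (ball a))) (+-mono-≤ (length-ball a) (length-ball b))))

  ∈-incident : ∀ {a b c d} → c ∈ ball a ++ ball b → Adj G c d → (c , d) ∈ incident (a , b)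
  ∈-incident {c = c} c∈ c~d = ∈-concatMap⁺ edgesAt (lose c∈ (∈-map⁺ (c ,_) (nbrs-complete c~d)))

  ∉-conflicts⇒far : ∀ {e f} → Adj G (proj₁ f) (proj₂ f) → f ∉ conflicts e → Far G e f
  ∉-conflicts⇒far {e@(a , b)} {c , d} c~d f∉ =
      (λ a-c → source (∈-++⁺ˡ (close⇒∈-ball a-c))) , (λ a-d → target (∈-++⁺ˡ (close⇒∈-ball a-d)))
    , (λ b-c → source (∈-++⁺ʳ (ball a) (close⇒∈-ball b-c))) , (λ b-d → target (∈-++⁺ʳ (ball a) (close⇒∈-ball b-d)))
    where
    source : c ∉ ball a ++ ball b
    source c∈ = f∉ (∈-++⁺ˡ (∈-incident c∈ c~d))
    target : d ∉ ball a ++ ball b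
    target d∈ = f∉ (∈-++⁺ʳ (incident e) (∈-map⁺ Product.swap (∈-incident d∈ (Graph.sym G c~d))))

  open DecMembership {A = Edge n} (≡-dec Finₚ._≟_ Finₚ._≟_) using (_∈?_)

  record Matching (L : List (Edge n)) : Set where
    field
      M         : List (Edge n)
      distant   : DistantMatching G M
      M⊆L       : All (_∈ L) M
      large     : length L ≤ suc conflictBound * length M

  -- Each chosen edge removes itself and at most `conflictBound` others. The recursive call is on a
  -- filtered list, so `fuel` bounds its length to make the recursion structural.
  greedy : ∀ fuel (L : List (Edge n)) → length L ≤ fuel → Unique L → All (λ e → Adj G (proj₁ e) (proj₂ e)) L → Matching L
  greedy fuel [] _ _ _ = record { M = [] ; distant = [] , [] ; M⊆L = [] ; large = z≤n }
  greedy (suc fuel) (e ∷ L) (s≤s L≤) (_ ∷ L!) (e-adj ∷ L-adj) = record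
    { M       = e ∷ M
    ; distant = e-adj ∷ proj₁ distant , All.map far M⊆L ∷ proj₂ distant
    ; M⊆L     = here refl ∷ All.map (there ∘ proj₁ ∘ ∈-filter⁻ free?) M⊆L
    ; large   = s≤s (begin
        length L                                                ≡⟨ length-filter-∁ (_∈? conflicts e) L ⟩
        length (filter (_∈? conflicts e) L) + length (filter free? L)
          -- The discarded edges are distinct and all occur in `conflicts e`.
          ≤⟨ +-mono-≤ (≤-trans (unique-⊆⇒length≤ (Uniqueₚ.filter⁺ (_∈? conflicts e) L!) (Allₚ.all-filter (_∈? conflicts e) L))
                               (length-conflicts e)) large ⟩
        conflictBound + suc conflictBound * length M            ≡⟨ suc-injective (≡-sym (*-suc (suc conflictBound) (length M))) ⟩
        _                                                       ∎)
    }
    where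
    open ≤-Reasoning
    free? : Decidable (_∉ conflicts e)
    free? = ∁? (_∈? conflicts e)
    open Matching (greedy fuel (filter free? L) (≤-trans (length-filter free? L) L≤) (Uniqueₚ.filter⁺ free? L!) (Allₚ.filter⁺ free? L-adj))
    far : ∀ {f} → f ∈ filter free? L → Far G e f
    far f∈ with ∈-filter⁻ free? f∈
    ... | f∈L , f∉ = ∉-conflicts⇒far (All.lookup L-adj f∈L) f∉

-- The recursive trees

Image : {A B : Set} → (A → B) → B → Set
Image f y = ∃ λ x → f x ≡ y

module _ {a b c : BinTree} where

  legA : Pos a → Pos (two a (two b c))
  legA = inl

  legB : Pos b → Pos (two a (two b c))
  legB = inr ∘ inl

  legC : Pos c → Pos (two a (two b c))
  legC = inr ∘ inr

  module _ {R : Pos (two a (two b c)) → Set} where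

    -- These links are used with `R` the complement of another leg. The nodes `root` and `inr root`
    -- lie in no leg, so they stay available when a leg is removed.
    linked-A : (∀ x → R (legA x)) → R root → ∀ x → Linked _~_ R root (legA x)
    linked-A RA Rr x = linked-trans (linked-edge swap (inj₂ refl) Rr (RA root))
                                    (linked-map legA ~-inl (λ _ → RA _) (root-linked x))

    linked-B : (∀ x → R (legB x)) → R (inr root) → ∀ x → Linked _~_ R (inr root) (legB x)
    linked-B RB Rm x = linked-trans (linked-edge swap (inj₂ refl) Rm (RB root))
                                    (linked-map legB (~-inr ∘ ~-inl) (λ _ → RB _) (root-linked x))

    linked-C : (∀ x → R (legC x)) → R (inr root) → ∀ x → Linked _~_ R (inr root) (legC x)
    linked-C RC Rm x = linked-trans (linked-edge swap (inj₂ refl) Rm (RC root))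
                                    (linked-map legC (~-inr ∘ ~-inr) (λ _ → RC _) (root-linked x))

    linked-m : R root → R (inr root) → Linked _~_ R root (inr root)
    linked-m = linked-edge swap (inj₂ refl)

-- `caterpillar p` has 2p + 1 nodes, the least odd number that reaches the 2p columns asked for by
-- `expand-base`; trees of this shape always have odd order.
caterpillar : ℕ → BinTree
caterpillar zero    = leaf
caterpillar (suc m) = two leaf (caterpillar m)

-- A root with three children and a parent would have degree 4; the second new node keeps it at 3.
nested : ℕ → ℕ → BinTree
nested p zero    = caterpillar p
nested p (suc h) = two (nested p h) (two (nested p h) (nested p h))

order-caterpillar : ∀ m → order (caterpillar m) ≡ suc (m + m)
order-caterpillar zero    = refl
order-caterpillar (suc m) = cong (2 +_) (trans (order-caterpillar m) (≡-sym (+-suc m m)))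

module _ {t : BinTree} {q : ℕ} (time : Pos t × Fin (suc q) → ℕ) (time-injective : ∀ {u v} → time u ≡ time v → u ≡ v) where

  open Ordered _~_ _≈_ time

  -- The induction runs over embedded copies `ι` inside one fixed tree `t`, so that all copies share
  -- the same `time` and their expansions can be compared.
  expansion : ∀ h (ι : Pos (nested p h) → Pos t) → (∀ {x y} → ι x ≡ ι y → x ≡ y) → (∀ {x y} → x ~ y → ι x ~ ι y) →
              Expansion (Image ι) h
  expansion zero ι ι-injective ι-hom =
    expand-base (cong proj₁ ∘ time-injective) (Uniqueₚ.map⁺ ι-injective (nodes! (caterpillar p)))
      (Allₚ.map⁺ (All.tabulate λ {x} _ → x , refl))
      (≤-trans (n≤1+n (p + p)) (≤-reflexive (≡-sym (trans (length-map ι (nodes (caterpillar p)))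
        (trans (length-nodes (caterpillar p)) (order-caterpillar p))))))
  expansion (suc h) ι ι-injective ι-hom = expand-median path-linked
    (λ (x , eq) → legA x , eq) (λ (x , eq) → legB x , eq) (λ (x , eq) → legC x , eq)
    -- With leg A removed, `inr root` joins B and C directly. With B or C removed, the other two
    -- legs are joined through the edge between `root` and `inr root`.
    (ι (inr root) , λ { (inj₁ (x , refl)) → off legA (λ ()) , lift legA (linked-B (λ _ ()) (λ ()) x)
                      ; (inj₂ (x , refl)) → off legA (λ ()) , lift legA (linked-C (λ _ ()) (λ ()) x) })
    (ι root       , λ { (inj₁ (x , refl)) → off legB (λ ()) , lift legB (linked-A (λ _ ()) (λ ()) x)
                      ; (inj₂ (x , refl)) → off legB (λ ()) , lift legB
                                              (linked-trans (linked-m (λ ()) (λ ())) (linked-C (λ _ ()) (λ ()) x)) })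
    (ι root       , λ { (inj₁ (x , refl)) → off legC (λ ()) , lift legC (linked-A (λ _ ()) (λ ()) x)
                      ; (inj₂ (x , refl)) → off legC (λ ()) , lift legC
                                              (linked-trans (linked-m (λ ()) (λ ())) (linked-B (λ _ ()) (λ ()) x)) })
    (expansion h (ι ∘ legA) (inl-injective ∘ ι-injective) (ι-hom ∘ ~-inl))
    (expansion h (ι ∘ legB) (inl-injective ∘ inr-injective ∘ ι-injective) (ι-hom ∘ ~-inr ∘ ~-inl))
    (expansion h (ι ∘ legC) (inr-injective ∘ inr-injective ∘ ι-injective) (ι-hom ∘ ~-inr ∘ ~-inr))
    where
    inl-injective : ∀ {l r} {x y : Pos l} → inl {r = r} x ≡ inl y → x ≡ y
    inl-injective refl = refl
    inr-injective : ∀ {l r} {x y : Pos r} → inr {l = l} x ≡ inr y → x ≡ y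
    inr-injective refl = refl
    off : ∀ (leg : Pos (nested p h) → Pos (nested p (suc h))) {x} → (∀ {y} → leg y ≢ x) → Image ι (ι x) × ¬ Image (ι ∘ leg) (ι x)
    off leg {x} ≢x = (x , refl) , λ (y , eq) → ≢x (ι-injective eq)
    lift : ∀ (leg : Pos (nested p h) → Pos (nested p (suc h))) {x y} → Linked _~_ (λ z → ∀ {w} → leg w ≢ z) x y →
           Linked _~_ (λ v → Image ι v × ¬ Image (ι ∘ leg) v) (ι x) (ι y)
    lift leg = linked-map ι ι-hom (off leg)

-- From cut edges to the lower bound on dmw

module _ (q h : ℕ) where

  open Grid (nested (suc q) h) (suc q)

  adj⇒∈-nbrs : ∀ {u v} → Adj grid u v → v ∈ nbrs u
  adj⇒∈-nbrs {u} {v} a = ∈-fromList⁻ (nbrs u) a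

  open Greedy grid nbrs 5 (λ {u} {v} → adj⇒∈-nbrs {u} {v}) length-nbrs

  dmw-lower-bound : ∀ d → DmwAtMost grid d → h * suc q ≤ 621 * d
  dmw-lower-bound d (σ , dmw≤d) = begin
    h * suc q             ≤⟨ hp≤∣cuts∣ ⟩
    length cuts           ≡⟨ length-map edge cuts ⟨
    length (map edge cuts) ≤⟨ large ⟩
    621 * length M        ≤⟨ *-monoʳ-≤ 621 (dmw≤d s s≤n M distant M-crosses) ⟩
    621 * d               ∎
    where
    open ≤-Reasoning
    time : Pos (nested (suc q) h) × Fin (suc q) → ℕ
    time u = toℕ (σ ⟨$⟩ʳ vertex u)

    time-injective : ∀ {u v} → time u ≡ time v → u ≡ v
    time-injective {u} {v} eq = vertex-injective
      (trans (≡-sym (inverseˡ σ)) (trans (cong (σ ⟨$⟩ˡ_) (toℕ-injective eq)) (inverseˡ σ)))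

    open Ordered _~_ _≈_ time
    open Expansion (expansion time time-injective h id id id)

    edge : Vertex × Vertex → Edge (order (nested (suc q) h) * suc q)
    edge (u , v) = vertex u , vertex v

    edge-injective : ∀ {e f} → edge e ≡ edge f → e ≡ f
    edge-injective eq = cong₂ _,_ (vertex-injective (cong proj₁ eq)) (vertex-injective (cong proj₂ eq))

    open Matching (greedy (length (map edge cuts)) (map edge cuts) ≤-refl (Uniqueₚ.map⁺ edge-injective cuts!)
                    (Allₚ.map⁺ (All.map (λ {e} ((b , _) , _) → adj⁺ {proj₁ e} {proj₂ e} b) cuts-valid)))

    crosses : All (λ e → InPrefix σ s (proj₁ e) × ¬ InPrefix σ s (proj₂ e)) (map edge cuts)
    crosses = Allₚ.map⁺ (All.map (λ {((x , i) , (y , j))} ((_ , u-in , v-out) , _) → early⇒< s x i u-in , late⇒≮ s y j v-out) cuts-valid)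

    M-crosses : CrossingP σ s M
    M-crosses = All.map (All.lookup crosses) M⊆L

    -- Since `p` is positive, `outs` is nonempty: some vertex is late at time `s`, and its position
    -- is at least `s` and below the number of vertices.
    s≤n : s ≤ order (nested (suc q) h) * suc q
    s≤n with outs | p≤∣outs∣ | outs-late
    ... | x ∷ _ | _ | (_ , i , late) ∷ _ = ≤-trans (≮⇒≥ (late⇒≮ s x i late)) (<⇒≤ (toℕ<n _))

-- Size estimates and choice of parameters

order-nested≤ : ∀ p h → suc (order (nested p h)) ≤ 4 ^ h * (2 + (p + p))
order-nested≤ p zero    = ≤-reflexive (trans (cong suc (order-caterpillar p)) (≡-sym (*-identityˡ _)))
order-nested≤ p (suc h) = begin
  -- Adding one turns the recurrence 3o + 2 into exact tripling; 3 is then rounded up to 4 to get a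
  -- power of two.
  suc (suc (o + suc (o + o))) ≡⟨ solve 1 (λ o → con 2 :+ (o :+ (con 1 :+ (o :+ o))) := con 3 :* (con 1 :+ o)) refl o ⟩
  3 * suc o                   ≤⟨ *-mono-≤ {3} {4} (n≤1+n 3) (order-nested≤ p h) ⟩
  4 * (4 ^ h * (2 + (p + p))) ≡⟨ *-assoc 4 (4 ^ h) (2 + (p + p)) ⟨
  4 ^ suc h * (2 + (p + p))   ∎
  where
  open ≤-Reasoning
  open +-*-Solver
  o = order (nested p h)

h<order-nested : ∀ p h → h < order (nested p h)
h<order-nested p zero    = s≤s z≤n
h<order-nested p (suc h) = s≤s (≤-trans (h<order-nested p h) (m≤m+n _ _))

n≤2^n : ∀ n → n ≤ 2 ^ n
n≤2^n zero    = z≤n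
n≤2^n (suc n) = ≤-trans (+-mono-≤ (m^n>0 2 n) (n≤2^n n)) (≤-reflexive (cong (2 ^ n +_) (≡-sym (+-identityʳ (2 ^ n)))))

-- `suc q` is k/2 rounded down. The first bound controls the treewidth, the second returns a
-- constant fraction of `k` in the lower bound.
half : ∀ k → 2 ≤ k → ∃ λ q → suc q + suc q ≤ k × k ≤ 4 * suc q
half (suc (suc zero))          _ = 0 , ≤-refl , s≤s (s≤s z≤n)
half (suc (suc (suc zero)))    _ = 0 , n≤1+n 2 , s≤s (s≤s (s≤s z≤n))
half (suc zero) (s≤s ())
half (suc (suc k@(suc (suc _)))) _ with half k (s≤s (s≤s z≤n))
... | q , 2p≤k , k≤4p = suc q
  , s≤s (≤-trans (≤-reflexive (+-suc (suc q) (suc q))) (s≤s 2p≤k))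
  , ≤-trans (+-mono-≤ {2} {4} (s≤s (s≤s z≤n)) k≤4p) (≤-reflexive (≡-sym (*-suc 4 (suc q))))

-- The logarithm is avoided by exponentiating: `n ^ k ≤ 2 ^ (b * d)` says that `d` is at least (log
-- n * k)/b. Quantifying over `N` makes the class infinite.
theorem3 : Σ ℕ λ b → 1 ≤ b × (∀ (k : ℕ) → 50 ≤ k → ∀ (N : ℕ) → Σ ℕ λ n → N ≤ n × Σ (Graph n) λ G → MaxDegree≤ G 5 × TreewidthAtMost G k × (∀ (d : ℕ) → DmwAtMost G d → n ^ k ≤ 2 ^ (b * d)))
-- 621 is the loss of the greedy selection; 12 = 3 * 4 comes from `n ≤ 2 ^ (3 * H)` and `k ≤ 4 * p`.
theorem3 = 12 * 621 , s≤s z≤n , construct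
  where
  construct : ∀ (k : ℕ) → 50 ≤ k → ∀ (N : ℕ) → Σ ℕ λ n → N ≤ n × Σ (Graph n) λ G → MaxDegree≤ G 5 × TreewidthAtMost G k × (∀ (d : ℕ) → DmwAtMost G d → n ^ k ≤ 2 ^ (12 * 621 * d))
  construct k 50≤k N with half k (≤-trans (s≤s (s≤s z≤n)) 50≤k)
  ... | q , 2p≤k , k≤4p = n , N≤n , grid , maxDegree≤5 , treewidth k (m≤n⇒m≤1+n 2p≤k) , bound
    where
    p H n : ℕ
    p = suc q
    -- The first summand makes `2 ^ H` absorb the factor `(2 + (p + p)) * p` of the bound on `n`;
    -- the second ensures `N ≤ n`.
    H = (2 + (p + p)) * p + N
    n = order (nested p H) * p
    open Grid (nested p H) p
    open ≤-Reasoning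

    N≤n : N ≤ n
    N≤n = begin
      N                    ≤⟨ m≤n+m N ((2 + (p + p)) * p) ⟩
      H                    ≤⟨ <⇒≤ (h<order-nested p H) ⟩
      order (nested p H)   ≤⟨ m≤m*n (order (nested p H)) p ⟩
      n                    ∎

    n≤8^H : n ≤ 2 ^ (3 * H)
    n≤8^H = begin
      order (nested p H) * p               ≤⟨ *-monoˡ-≤ p (<⇒≤ (order-nested≤ p H)) ⟩
      4 ^ H * (2 + (p + p)) * p            ≡⟨ *-assoc (4 ^ H) (2 + (p + p)) p ⟩
      4 ^ H * ((2 + (p + p)) * p)          ≤⟨ *-monoʳ-≤ (4 ^ H) (≤-trans (m≤m+n _ N) (n≤2^n H)) ⟩
      4 ^ H * 2 ^ H                        ≡⟨ cong (_* 2 ^ H) (^-*-assoc 2 2 H) ⟩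
      2 ^ (2 * H) * 2 ^ H                  ≡⟨ ^-distribˡ-+-* 2 (2 * H) H ⟨
      2 ^ (2 * H + H)                      ≡⟨ cong (2 ^_) (+-comm (2 * H) H) ⟩
      2 ^ (3 * H)                          ∎

    bound : ∀ d → DmwAtMost grid d → n ^ k ≤ 2 ^ (12 * 621 * d)
    bound d dmw≤d = begin
      n ^ k                    ≤⟨ ^-monoˡ-≤ k n≤8^H ⟩
      (2 ^ (3 * H)) ^ k        ≡⟨ ^-*-assoc 2 (3 * H) k ⟩
      2 ^ (3 * H * k)          ≤⟨ ^-monoʳ-≤ 2 exponent ⟩
      2 ^ (12 * 621 * d)       ∎
      where
      open +-*-Solver
      exponent : 3 * H * k ≤ 12 * 621 * d
      exponent = begin
        3 * H * k            ≤⟨ *-monoʳ-≤ (3 * H) k≤4p ⟩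
        3 * H * (4 * p)      ≡⟨ solve 2 (λ H p → con 3 :* H :* (con 4 :* p) := con 12 :* (H :* p)) refl H p ⟩
        12 * (H * p)         ≤⟨ *-monoʳ-≤ 12 (dmw-lower-bound q H d dmw≤d) ⟩
        12 * (621 * d)       ≡⟨ *-assoc 12 621 d ⟨
        12 * 621 * d         ∎
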